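{- Let $U:\mathbb{N}\to\mathbb{N}$ be any function with $U(x)\ge p_{x+1}-1$ for all integers $x\ge 0$. For integers $j\ge 2$ define \[ I(j)=\left\lfloor \frac{1}{1+\sum_{k=2}^{j-1}\left\lfloor \frac{\gcd(k,j)}{k}\right\rfloor}\right\rfloor, \] for integers $i\ge 1$ define $S(i)=\sum_{j=2}^{i} I(j)$ (so $S(1)=0$), for integers $i\ge 1$, $x\ge 0$ define \[ A(i,x)=\left\lfloor \frac{1}{1+\left\lfloor \frac{S(i)}{x+1}\right\rfloor}\right\rfloor, \] and define $f_{U}(x)=1+\sum_{i=1}^{U(x)} A(i,x)$. Then for every integer $x\ge 0$, $f_{U}(x)=p_{x+1}$.
   Context: $\mathbb{N}=\{0,1,2,\dots\}$. $p_n$ denotes the $n$-th prime ($p_1=2$, $p_2=3,\dots$). $\lfloor\cdot\rfloor$ is the floor function and $\gcd$ the usual greatest common divisor; empty sums are $0$. -}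

module Defs where

open import Data.List using (applyUpTo)
open import Data.Nat
open import Data.Nat.ListAction using (sum)
open import Data.Nat.Properties
open import Data.Nat.Divisibility
open import Data.Nat.DivMod using (_/_)
open import Data.Nat.GCD using (gcd)
open import Data.Nat.Primality
open import Data.Product using (∃; _×_; _,_)
open import Relation.Binary.PropositionalEquality using (_≡_; refl; sym; subst)
open import Relation.Nullary using (¬_; yes; no; contradiction)
open import Relation.Unary using (Decidable)

record Least (P : ℕ → Set) (m : ℕ) : Set where
  constructor least
  field
    value   : ℕ
    m≤value : m ≤ value
    holds   : P value
    minimal : ∀ {k} → m ≤ k → k < value → ¬ P k

open Least public

findLeast : ∀ {P : ℕ → Set} → Decidable P → ∀ m d → P (m + d) → Least P m
findLeast {P} P? m zero    p = least m ≤-refl (subst P (+-identityʳ m) p)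
  λ m≤k k<m → contradiction k<m (≤⇒≯ m≤k)
findLeast {P} P? m (suc d) p with P? m
... | yes pm = least m ≤-refl pm λ m≤k k<m → contradiction k<m (≤⇒≯ m≤k)
... | no ¬pm with findLeast P? (suc m) d (subst P (+-suc m d) p)
...   | least v m<v pv min = least v (<⇒≤ m<v) pv min′
  where
  min′ : ∀ {k} → m ≤ k → k < v → ¬ P k
  min′ {k} m≤k k<v pk with m ≟ k
  ... | yes refl = ¬pm pk
  ... | no  m≢k  = min (≤∧≢⇒< m≤k m≢k) k<v pk

-- Euclid: the least divisor ≥ 2 of 1 + n ! is a prime exceeding n.
primeAbove : ∀ n → ∃ λ p → n < p × Prime p
primeAbove n = p , ≰⇒> p≰n , p-prime
  where
  N = suc (n !)

  divisor : Least (_∣ N) 2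
  divisor = findLeast (_∣? N) 2 (N ∸ 2)
    (subst (_∣ N) (sym (m+[n∸m]≡n (s≤s (1≤n! n)))) ∣-refl)

  p = value divisor

  instance
    p-nonTrivial : NonTrivial p
    p-nonTrivial = n>1⇒nonTrivial (m≤value divisor)

  p-prime : Prime p
  p-prime = rough∧∣⇒prime
    (λ (hasNonTrivialDivisor {divisor = k} k<p k∣N) →
      minimal divisor (nonTrivial⇒n>1 k) k<p k∣N)
    (holds divisor)

  p≰n : ¬ p ≤ n
  p≰n p≤n = contradiction
    (∣1⇒≡1 (∣m+n∣m⇒∣n (subst (p ∣_) (+-comm 1 (n !)) (holds divisor)) p∣n!))
    (nonTrivial⇒≢1 {p})
    where
    p∣n! : p ∣ n !
    p∣n! = ∣-trans (m∣m! p {{nonTrivial⇒nonZero p}}) (m≤n⇒m!∣n! p≤n)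
      where
      m∣m! : ∀ m .{{_ : NonZero m}} → m ∣ m !
      m∣m! (suc m) = m∣m*n (m !)

leastPrimeAbove : ∀ n → Least Prime (suc n)
leastPrimeAbove n with primeAbove n
... | p , n<p , p-prime = findLeast prime? (suc n) (p ∸ suc n)
  (subst Prime (sym (m+[n∸m]≡n n<p)) p-prime)

nextPrime : ℕ → ℕ
nextPrime n = value (leastPrimeAbove n)

-- The n-th prime, counted from nthPrime 1 ≡ 2.
nthPrime : (n : ℕ) .{{_ : NonZero n}} → ℕ
nthPrime 1             = 2
nthPrime (suc (suc n)) = nextPrime (nthPrime (suc n))

-- ∑[ k ≔ a to b ] f k  =  f a + f (a + 1) + ⋯ + f b, which is 0 if b < a.
-- The lower limit is positive, so that summands may divide by k.
∑ : (a b : ℕ) .{{_ : NonZero a}} → ((k : ℕ) .{{_ : NonZero k}} → ℕ) → ℕ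
∑ (suc a) b f = sum (applyUpTo (λ i → f (suc (a + i))) (b ∸ a))

syntax ∑ a b (λ k → e) = ∑[ k ≔ a to b ] e
infixr 5 ∑

-- Natural-number division _/_ already is the floor of the quotient.

-- The range j ≥ 2 of the paper is enforced by the only use, in S.
I : ℕ → ℕ
I j = 1 / (1 + (∑[ k ≔ 2 to j ∸ 1 ] gcd k j / k))

-- The range i ≥ 1 of S and A is enforced by the sum in f.
S : ℕ → ℕ
S i = ∑[ j ≔ 2 to i ] I j

A : ℕ → ℕ → ℕ
A i x = 1 / (1 + S i / suc x)

f : (ℕ → ℕ) → ℕ → ℕ
f U x = 1 + (∑[ i ≔ 1 to U x ] A i x)

{-# OPTIONS --safe #-}
-- ⌊ gcd(k, j) / k ⌋ is the indicator of k ∣ j and ⌊ 1 / (1 + n) ⌋ that of n = 0.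
-- Hence I j is the indicator of "j is prime", S i = π(i), and A i x is the
-- indicator of π(i) ≤ x, that is, of i < p_{x+1}.  So the sum in f counts the
-- p_{x+1} - 1 positive integers below p_{x+1}.
module Submission where

open import Defs
open import Data.List using (applyUpTo; [_]; _∷ʳ_)
open import Data.List.Properties using (applyUpTo-∷ʳ)
open import Data.Nat using (ℕ; zero; suc; _+_; _∸_; _/_; _≤_; _<_; _≥_; _≤′_; ≤′-refl; ≤′-step; z≤n; s≤s; s<s; NonZero; nonTrivial⇒n>1)
open import Data.Nat.Divisibility using (_∣_; _∤_; ∣-refl; ∣-antisym; ∣⇒≤; hasNonTrivialDivisor)
open import Data.Nat.DivMod using (m<n⇒m/n≡0; m≥n⇒m/n>0)
open import Data.Nat.GCD using (gcd; gcd[m,n]∣m; gcd[m,n]∣n; gcd-greatest)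
open import Data.Nat.ListAction using (sum)
open import Data.Nat.ListAction.Properties using (sum-++)
open import Data.Nat.Primality using (Prime; prime; prime[2]; prime⇒nonTrivial; ¬prime⇒composite)
open import Data.Nat.Properties
open import Relation.Binary.PropositionalEquality using (_≡_; refl; sym; trans; cong; cong₂; subst; module ≡-Reasoning)
open import Relation.Nullary using (¬_)

sum-applyUpTo-suc : ∀ (g : ℕ → ℕ) n →
  sum (applyUpTo g (suc n)) ≡ sum (applyUpTo g n) + g n
sum-applyUpTo-suc g n = begin
  sum (applyUpTo g (suc n))           ≡⟨ cong sum (applyUpTo-∷ʳ g n) ⟨
  sum (applyUpTo g n ∷ʳ g n)          ≡⟨ sum-++ (applyUpTo g n) [ g n ] ⟩
  sum (applyUpTo g n) + (g n + 0)     ≡⟨ cong (sum (applyUpTo g n) +_) (+-identityʳ (g n)) ⟩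
  sum (applyUpTo g n) + g n           ∎
  where open ≡-Reasoning

term≤sum-applyUpTo : ∀ (g : ℕ → ℕ) {i n} → i < n → g i ≤ sum (applyUpTo g n)
term≤sum-applyUpTo g {zero}  {suc n} _         = m≤m+n (g 0) _
term≤sum-applyUpTo g {suc i} {suc n} (s≤s i<n) =
  m≤n⇒m≤o+n (g 0) (term≤sum-applyUpTo (λ k → g (suc k)) i<n)

sum-applyUpTo-zeros : ∀ (g : ℕ → ℕ) n → (∀ {i} → i < n → g i ≡ 0) →
  sum (applyUpTo g n) ≡ 0
sum-applyUpTo-zeros g zero    _  = refl
sum-applyUpTo-zeros g (suc n) g0 = cong₂ _+_ (g0 (s≤s z≤n))
  (sum-applyUpTo-zeros (λ k → g (suc k)) n (λ i<n → g0 (s<s i<n)))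

-- The length `n` may exceed `m` by any amount, since later terms vanish; this is why `U` in the
-- theorem need only satisfy a lower bound.
sum-applyUpTo-indicator : ∀ (g : ℕ → ℕ) {m n} → m ≤ n →
  (∀ {i} → i < m → g i ≡ 1) → (∀ {i} → m ≤ i → g i ≡ 0) →
  sum (applyUpTo g n) ≡ m
sum-applyUpTo-indicator g {n = n} z≤n _ g0 = sum-applyUpTo-zeros g n (λ _ → g0 z≤n)
sum-applyUpTo-indicator g (s≤s m≤n) g1 g0  = cong₂ _+_ (g1 (s≤s z≤n))
  (sum-applyUpTo-indicator (λ k → g (suc k)) m≤n
    (λ i<m → g1 (s<s i<m)) (λ m≤i → g0 (s≤s m≤i)))

1/[1+n]≡1 : ∀ {n} → n ≡ 0 → 1 / (1 + n) ≡ 1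
1/[1+n]≡1 refl = refl

1/[1+n]≡0 : ∀ {n} → 0 < n → 1 / (1 + n) ≡ 0
1/[1+n]≡0 0<n = m<n⇒m/n≡0 (s<s 0<n)

∣⇒gcd/>0 : ∀ {k j} .{{_ : NonZero k}} → k ∣ j → 0 < gcd k j / k
∣⇒gcd/>0 {k} {j} k∣j = m≥n⇒m/n>0
  (≤-reflexive (∣-antisym (gcd-greatest ∣-refl k∣j) (gcd[m,n]∣m k j)))

-- The gcd is at most `k`, and equality would make `k` a divisor of `j`; so here it is strictly
-- below `k`.
∤⇒gcd/≡0 : ∀ {k j} .{{_ : NonZero k}} → k ∤ j → gcd k j / k ≡ 0
∤⇒gcd/≡0 {k} {j} k∤j = m<n⇒m/n≡0 (≤∧≢⇒< (∣⇒≤ (gcd[m,n]∣m k j))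
  (λ gcd≡k → k∤j (subst (_∣ j) gcd≡k (gcd[m,n]∣n k j))))

I-prime : ∀ n → Prime (2 + n) → I (2 + n) ≡ 1
I-prime n (prime notComposite) = 1/[1+n]≡1 (sum-applyUpTo-zeros _ n
  -- The sum in `I (2 + n)` has `n` terms, and index `i` stands for `k = 2 + i`: these are exactly
  -- the candidates for a nontrivial proper divisor.
  (λ {i} i<n → ∤⇒gcd/≡0 {2 + i} (λ k∣j →
    notComposite (hasNonTrivialDivisor (s<s (s<s i<n)) k∣j))))

-- A single proper divisor suffices: its term is positive, hence so is the whole sum.
I-nonprime : ∀ n → ¬ Prime (2 + n) → I (2 + n) ≡ 0
I-nonprime n ¬p with ¬prime⇒composite ¬p
... | hasNonTrivialDivisor {divisor = suc (suc i)} (s≤s (s≤s i<n)) k∣j =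
  1/[1+n]≡0 (≤-trans (∣⇒gcd/>0 k∣j)
    (term≤sum-applyUpTo (λ i → gcd (2 + i) (2 + n) / (2 + i)) i<n))

S-suc : ∀ n → S (2 + n) ≡ S (1 + n) + I (2 + n)
S-suc = sum-applyUpTo-suc (λ i → I (2 + i))

S-mono : ∀ {m n} → m ≤′ n → S m ≤ S n
S-mono ≤′-refl                         = ≤-refl
-- `S-suc` starts only at 2, but truncated subtraction makes `S 0` and `S 1` both reduce to 0.
S-mono {n = suc zero}    (≤′-step m≤n) = S-mono m≤n
S-mono {n = suc (suc n)} (≤′-step m≤n) = ≤-trans (S-mono m≤n)
  (≤-trans (m≤m+n (S (1 + n)) _) (≤-reflexive (sym (S-suc n))))

S-primeFree : ∀ {m n} → m ≤′ n → (∀ {k} → m < k → k ≤ n → ¬ Prime k) → S n ≡ S m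
S-primeFree ≤′-refl _ = refl
S-primeFree {n = suc zero} (≤′-step m≤n) free =
  S-primeFree m≤n (λ m<k k≤n → free m<k (m≤n⇒m≤1+n k≤n))
S-primeFree {m} {suc (suc n)} (≤′-step m≤n) free = begin
  S (2 + n)              ≡⟨ S-suc n ⟩
  S (1 + n) + I (2 + n)  ≡⟨ cong₂ _+_
    (S-primeFree m≤n (λ m<k k≤n → free m<k (m≤n⇒m≤1+n k≤n)))
    (I-nonprime n (free (s≤s (≤′⇒≤ m≤n)) ≤-refl)) ⟩
  S m + 0                ≡⟨ +-identityʳ (S m) ⟩
  S m                    ∎
  where open ≡-Reasoning

prime⇒>1 : ∀ {p} → Prime p → 1 < p
prime⇒>1 {p} p-prime = nonTrivial⇒n>1 p {{prime⇒nonTrivial p-prime}}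

S-prime : ∀ {p} → Prime p → S p ≡ suc (S (p ∸ 1))
-- The bound `1 < p` excludes 0 and 1, so that `S-suc` applies.
S-prime p-prime with prime⇒>1 p-prime
S-prime {suc (suc n)} p-prime | _ = begin
  S (2 + n)              ≡⟨ S-suc n ⟩
  S (1 + n) + I (2 + n)  ≡⟨ cong (S (1 + n) +_) (I-prime n p-prime) ⟩
  S (1 + n) + 1          ≡⟨ +-comm (S (1 + n)) 1 ⟩
  suc (S (1 + n))        ∎
  where open ≡-Reasoning

nthPrime-prime : ∀ x → Prime (nthPrime (suc x))
nthPrime-prime zero    = prime[2]
nthPrime-prime (suc x) = holds (leastPrimeAbove (nthPrime (suc x)))

S-nextPrime∸1 : ∀ n → S (nextPrime n ∸ 1) ≡ S n
S-nextPrime∸1 n with leastPrimeAbove n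
-- With the next prime written as `suc q`, its minimality says that no prime lies in the interval
-- from `n + 1` to `q`.
... | least (suc q) (s≤s n≤q) _ gap = S-primeFree (≤⇒≤′ n≤q) (λ n<k k≤q → gap n<k (s≤s k≤q))

-- Induction along the primes: reaching a prime raises `S` by one, and the gap after it leaves `S`
-- unchanged. The base case is `S 1`, an empty sum.
S-nthPrime∸1 : ∀ x → S (nthPrime (suc x) ∸ 1) ≡ x
S-nthPrime∸1 zero    = refl
S-nthPrime∸1 (suc x) = begin
  S (nthPrime (2 + x) ∸ 1)        ≡⟨ S-nextPrime∸1 (nthPrime (suc x)) ⟩
  S (nthPrime (suc x))            ≡⟨ S-prime (nthPrime-prime x) ⟩
  suc (S (nthPrime (suc x) ∸ 1))  ≡⟨ cong suc (S-nthPrime∸1 x) ⟩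
  suc x                           ∎
  where open ≡-Reasoning

S-nthPrime : ∀ x → S (nthPrime (suc x)) ≡ suc x
S-nthPrime x = trans (S-prime (nthPrime-prime x)) (cong suc (S-nthPrime∸1 x))

mainTheorem1 : (U : ℕ → ℕ) → (∀ x → U x ≥ nthPrime (suc x) ∸ 1) →
    ∀ x → f U x ≡ nthPrime (suc x)
mainTheorem1 U U≥ x = begin
  f U x        ≡⟨ cong suc (sum-applyUpTo-indicator (λ i → A (suc i) x) (U≥ x) below above) ⟩
  1 + (p ∸ 1)  ≡⟨ 1+[p∸1]≡p ⟩
  p            ∎
  where
  open ≡-Reasoning

  p = nthPrime (suc x)

  1+[p∸1]≡p : 1 + (p ∸ 1) ≡ p
  1+[p∸1]≡p = m+[n∸m]≡n (<⇒≤ (prime⇒>1 (nthPrime-prime x)))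

  below : ∀ {i} → i < p ∸ 1 → A (suc i) x ≡ 1
  -- Monotonicity gives `S (suc i) ≤ S (p ∸ 1)`, which equals `x`, so the division by `suc x` yields
  -- 0.
  below i<p∸1 = 1/[1+n]≡1 (m<n⇒m/n≡0 (s≤s
    (≤-trans (S-mono (≤⇒≤′ i<p∸1)) (≤-reflexive (S-nthPrime∸1 x)))))

  above : ∀ {i} → p ∸ 1 ≤ i → A (suc i) x ≡ 0
  -- From `p` on, `S` is at least `S p`, which equals `suc x`, so the inner quotient is positive.
  above {i} p∸1≤i = 1/[1+n]≡0 (m≥n⇒m/n>0
    (≤-trans (≤-reflexive (sym (S-nthPrime x))) (S-mono (≤⇒≤′ p≤1+i))))
    where
    p≤1+i : p ≤ suc i
    p≤1+i = subst (_≤ suc i) 1+[p∸1]≡p (s≤s p∸1≤i)
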